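{- Let $n \geq 3$ be an integer. Let $G_{\mathrm{pr}}(\mathbb{F}_2^n)$ be the phase-rotation distance graph over $\mathbb{F}_2$, and let $\alpha_2$ denote the $2$-independence number. Then \[ \alpha_2(G_{\mathrm{pr}}(\mathbb{F}_2^n)) \leq \begin{cases} 2^n \frac{n-2}{n(n+4)} & \text{if } n \equiv 0 \pmod 4, \\ 2^n \frac{n-3}{(n+3)(n-1)} & \text{if } n \equiv 1 \pmod 4, \\ 2^n \frac{1}{n+2} & \text{if } n \equiv 2 \pmod 4, \\ 2^n \frac{1}{n+5} & \text{if } n \equiv 3 \pmod 4 . \end{cases} \]
   Context: Let $q$ be a prime power (here $q=2$). Let $\mathbf{e}_1,\ldots,\mathbf{e}_n$ be the standard basis of $\mathbb{F}_q^n$ and $\mathbf{1}$ the all-ones vector. Put $F_i=\mathrm{span}(\mathbf{e}_i)$ for $i=1,\ldots,n$ and $F_{n+1}=\mathrm{span}(\mathbf{1})$. The phase-rotation weight of $\mathbf{x}\in\mathbb{F}_q^n$ is $w_{\mathrm{pr}}(\mathbf{x})=\min\{|I| : I\subseteq\{1,\ldots,n+1\},\ \mathbf{x}\in\mathrm{span}(\bigcup_{i\in I}F_i)\}$, and the phase-rotation distance is $d_{\mathrm{pr}}(\mathbf{x},\mathbf{y})=w_{\mathrm{pr}}(\mathbf{x}-\mathbf{y})$. The phase-rotation distance graph $G_{\mathrm{pr}}(\mathbb{F}_q^n)$ is the graph with vertex set $\mathbb{F}_q^n$ in which $\mathbf{x},\mathbf{y}$ are adjacent if and only if $d_{\mathrm{pr}}(\mathbf{x},\mathbf{y})=1$.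 For a graph $G$, the $k$-independence number $\alpha_k(G)$ is the size of the largest set of vertices such that any two distinct vertices in the set are at geodesic distance greater than $k$ in $G$. -}

module Defs where

open import Algebra.Bundles using (CommutativeRing)
open import Data.Bool using (if_then_else_)
open import Data.Fin using (Fin)
open import Data.Fin.Patterns using (0F; 1F; 2F; 3F)
import Data.Fin.Properties as Fin
open import Data.Fin.Subset using (Subset; _∈_; ∣_∣)
import Data.Fin.Subset as Subset
import Data.Fin.Subset.Properties as Subset
open import Data.Integer using (+_)
open import Data.List using (List; length)
import Data.List.Membership.Propositional as List
open import Data.List.Relation.Unary.Unique.Propositional using (Unique)
open import Data.Nat using (ℕ; suc; _∸_; _^_; _≤_; _<_; _≥_; s≤s)
import Data.Nat as ℕ
open import Data.Nat.DivMod using (_mod_)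
import Data.Parity.Properties as Parity
open import Data.Product using (∃-syntax; _×_; _,_)
open import Data.Rational using (ℚ; _/_)
import Data.Rational as ℚ
open import Data.Vec using (Vec; []; _∷_; _∷ʳ_; lookup; map; replicate; tabulate; zipWith)
import Data.Vec.Properties as Vec
open import Level using (Level)
open import Relation.Binary.PropositionalEquality
  using (_≡_; _≢_; refl; sym; cong₂; subst)
open import Relation.Nullary using (¬_; does)
open import Relation.Unary using (Pred; ⋃; ｛_｝)

private
  variable
    ℓ : Level
    n : ℕ

IsLeast : Pred ℕ ℓ → Pred ℕ ℓ
IsLeast P m = P m × (∀ k → P k → m ≤ k)

IsGreatest : Pred ℕ ℓ → Pred ℕ ℓ
IsGreatest P m = P m × (∀ k → P k → k ≤ m)

-- The field with two elements: the library's ring of parities.  Its negation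
-- is the identity; Data.Parity.Base._⁻¹ is not it (that one is x ↦ 1 + x).

open CommutativeRing Parity.+-*-commutativeRing public
  using (0#; 1#)
  renaming (Carrier to 𝔽₂; _+_ to _+₂_; _*_ to _*₂_; _-_ to _-₂_)

𝔽₂^_ : ℕ → Set
𝔽₂^ n = Vec 𝔽₂ n

infixl 6 _+ᵥ_ _-ᵥ_
infixr 7 _*ᵥ_

_+ᵥ_ _-ᵥ_ : 𝔽₂^ n → 𝔽₂^ n → 𝔽₂^ n
_+ᵥ_ = zipWith _+₂_
_-ᵥ_ = zipWith _-₂_

_*ᵥ_ : 𝔽₂ → 𝔽₂^ n → 𝔽₂^ n
c *ᵥ x = map (c *₂_) x

𝟎 𝟏 : 𝔽₂^ n
𝟎 = replicate _ 0#
𝟏 = replicate _ 1#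

𝐞 : Fin n → 𝔽₂^ n
𝐞 i = tabulate λ j → if does (i Fin.≟ j) then 1# else 0#

-- Finite linear combinations of elements of X.
data Span {n} (X : Pred (𝔽₂^ n) ℓ) : Pred (𝔽₂^ n) ℓ where
  zeroˢ : Span X 𝟎
  addˢ  : ∀ c {v x} → X v → Span X x → Span X (c *ᵥ v +ᵥ x)

-- F₁ = ⟨𝐞₁⟩, …, Fₙ = ⟨𝐞ₙ⟩, Fₙ₊₁ = ⟨𝟏⟩, with indices shifted down by one.
F : Fin (suc n) → Pred (𝔽₂^ n) _
F i = Span ｛ lookup (tabulate 𝐞 ∷ʳ 𝟏) i ｝

SpannedBy : Subset (suc n) → Pred (𝔽₂^ n) _
SpannedBy I = Span (⋃[ (i , _) ∶ (∃[ i ] i ∈ I) ] F i)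

-- Minima and maxima are given as relations: IsWeight x w reads "w_pr(x) = w".
IsWeight : 𝔽₂^ n → ℕ → Set
IsWeight x = IsLeast λ w → ∃[ I ] (∣ I ∣ ≡ w × SpannedBy I x)

IsDistance : 𝔽₂^ n → 𝔽₂^ n → ℕ → Set
IsDistance x y = IsWeight (x -ᵥ y)

record Graph : Set₁ where
  field
    Vertex    : Set
    Adjacent  : Vertex → Vertex → Set
    symmetric : ∀ {x y} → Adjacent x y → Adjacent y x
    loopless  : ∀ {x} → ¬ Adjacent x x

module _ (G : Graph) where
  open Graph G

  data Walk : ℕ → Vertex → Vertex → Set where
    stop : ∀ {x} → Walk 0 x x
    step : ∀ {l x y z} → Adjacent x y → Walk l y z → Walk (suc l) x z

  -- The geodesic distance is the length of a shortest walk, and ∞ if there is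
  -- no walk; so it exceeds k exactly when every walk is longer than k.
  DistanceExceeds : ℕ → Vertex → Vertex → Set
  DistanceExceeds k x y = ∀ l → Walk l x y → k < l

  Independent : ℕ → List Vertex → Set
  Independent k S =
    ∀ {x y} → x List.∈ S → y List.∈ S → x ≢ y → DistanceExceeds k x y

  -- IsIndependenceNumber k a reads "α_k(G) = a"; a finite vertex set is a
  -- list without repetitions.
  IsIndependenceNumber : ℕ → ℕ → Set
  IsIndependenceNumber k =
    IsGreatest λ a → ∃[ S ] (Unique S × Independent k S × length S ≡ a)

x-y≡y-x : (x y : 𝔽₂^ n) → x -ᵥ y ≡ y -ᵥ x
x-y≡y-x x y = Vec.zipWith-comm Parity.+-comm x y

x-x≡𝟎 : (x : 𝔽₂^ n) → x -ᵥ x ≡ 𝟎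
x-x≡𝟎 []      = refl
x-x≡𝟎 (a ∷ x) = cong₂ _∷_ (Parity.p+p≡0ℙ a) (x-x≡𝟎 x)

G-pr : ℕ → Graph
G-pr n = record
  { Vertex    = 𝔽₂^ n
  ; Adjacent  = λ x y → IsDistance x y 1
  ; symmetric = λ {x} {y} → subst (λ v → IsWeight v 1) (x-y≡y-x x y)
  ; loopless  = λ {x} (_ , least) → 1≰0
      (least 0 (Subset.⊥ , Subset.∣⊥∣≡0 (suc n) , subst (SpannedBy Subset.⊥) (sym (x-x≡𝟎 x)) zeroˢ))
  }
  where
  1≰0 : ¬ (1 ≤ 0)
  1≰0 ()

-- The truncated subtractions are exact since n ≥ 3; matching on n ≥ 3 makes
-- the denominators visibly nonzero.
bound : (n : ℕ) → n ≥ 3 → ℚ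
bound n@(suc (suc (suc _))) (s≤s (s≤s (s≤s _))) = + (2 ^ n) / 1 ℚ.* factor (n mod 4)
  where
  factor : Fin 4 → ℚ
  factor 0F = + (n ∸ 2) / (n ℕ.* (n ℕ.+ 4))
  factor 1F = + (n ∸ 3) / ((n ℕ.+ 3) ℕ.* (n ∸ 1))
  factor 2F = + 1 / (n ℕ.+ 2)
  factor 3F = + 1 / (n ℕ.+ 5)

{-# OPTIONS --safe #-}
module Submission where

-- The graph is the Cayley graph of 𝔽₂ⁿ whose N = n + 1 generators are 𝐞₁, …, 𝐞ₙ and 𝟏; its
-- eigenvalues are the character sums λ(u) = Σᵢ χᵤ(gen i), and all of them are congruent to N
-- modulo 4.  With r = N mod 4, the quadratic p(λ) = (λ − r)(λ − r + 4) is therefore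
-- nonnegative on the spectrum.  For S with pairwise distances greater than 2, consider
-- Σᵤ p(λ(u)) (Σ_{x ∈ S} χᵤ(x))².  Dropping all terms but u = 𝟎 bounds it below by p(N) |S|².
-- Since p has degree 2, orthogonality of characters kills the contribution of every pair
-- of distinct elements of S, and the value is |S| 2ⁿ (N + p(0)), because the adjacency matrix
-- has zero diagonal and its square has constant diagonal N.

open import Defs
open import Data.Nat using (ℕ; _≥_)
open import Data.Integer using (+_)
open import Data.Rational using (_/_; _≤_)

open import Data.Bool using (if_then_else_)
open import Data.Fin using (Fin; zero; suc; inject₁; fromℕ; punchIn)
open import Data.Fin.Patterns using (0F; 1F; 2F; 3F)
import Data.Fin.Properties as Fin
open import Data.Fin.Relation.Unary.Top using (view; ‵fromℕ; ‵inject₁)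
open import Data.Fin.Subset using (Subset; ⁅_⁆; ∣_∣) renaming (_∈_ to _∈ₛ_)
import Data.Fin.Subset.Properties as Subset
open import Data.Integer as ℤ using (_+_; _*_; _-_; ℤ; 0ℤ; 1ℤ; -1ℤ)
import Data.Integer.Properties as ℤ
open import Data.Integer.Tactic.RingSolver using (solve-∀)
open import Data.List as List using (List; []; _∷_; length)
open import Data.List.Membership.Propositional.Properties using (∈-lookup)
import Data.List.Relation.Unary.All as All
open import Data.List.Relation.Unary.AllPairs using ([]; _∷_)
open import Data.List.Relation.Unary.Unique.Propositional using (Unique)
open import Data.Nat as ℕ using (zero; suc; z≤n; s≤s; _^_; _∸_)
import Data.Nat.DivMod as ℕ
import Data.Nat.Properties as ℕ
open import Data.Parity.Base using (0ℙ; 1ℙ)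
import Data.Parity.Properties as Parity
open import Data.Product using (_×_; _,_; ∃-syntax; proj₁; proj₂)
import Data.Rational as ℚ
import Data.Rational.Properties as ℚ
import Data.Rational.Unnormalised as ℚᵘ
import Data.Rational.Unnormalised.Properties as ℚᵘ
open import Data.Sum using (_⊎_; inj₁; inj₂)
open import Data.Vec using (Vec; []; _∷_; _∷ʳ_; head; lookup; replicate; tabulate)
import Data.Vec.Properties as Vec
open import Function using (_∘_)
open import Relation.Binary.PropositionalEquality
open import Relation.Nullary using (contradiction; does; yes; no)
open import Relation.Unary using (Pred)

open import Algebra.Properties.Semiring.Sum ℤ.+-*-semiring
open import Algebra.Properties.CommutativeSemigroup ℤ.+-commutativeSemigroup
  using () renaming (interchange to +-interchange)
open import Algebra.Properties.CommutativeSemigroup ℤ.*-commutativeSemigroup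
  using () renaming (interchange to *-interchange; x∙yz≈y∙xz to x*[y*z]≡y*[x*z])

private
  variable
    m n : ℕ

-- Finite sums, and sums over the cube.

sum-const : ∀ m (c : ℤ) → ∑[ _ < m ] c ≡ + m * c
sum-const zero    c = sym (ℤ.*-zeroˡ c)
sum-const (suc m) c = begin
  c + ∑[ _ < m ] c      ≡⟨ cong (_+_ c) (sum-const m c) ⟩
  c + + m * c         ≡⟨ ℤ.suc-* (+ m) c ⟨
  + suc m * c           ∎
  where open ≡-Reasoning

sum-zero : {f : Fin m → ℤ} → (∀ i → f i ≡ 0ℤ) → sum f ≡ 0ℤ
sum-zero {m} f≡0 = trans (sum-cong-≗ f≡0) (sum-replicate-zero m)

sum-single : ∀ (j : Fin m) (f : Fin m → ℤ) → (∀ i → i ≢ j → f i ≡ 0ℤ) → sum f ≡ f j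
sum-single {suc m} j f f≡0 = begin
  sum f                          ≡⟨ sum-remove {i = j} f ⟩
  f j + sum (f ∘ punchIn j)    ≡⟨ cong (_+_ (f j)) (sum-zero λ i → f≡0 _ (Fin.punchInᵢ≢i j i)) ⟩
  f j + 0ℤ                     ≡⟨ ℤ.+-identityʳ (f j) ⟩
  f j                            ∎
  where open ≡-Reasoning

-- Recursion on the first coordinate matches that of `χ`, and `𝟎` always falls in the first half.
cubeSum : ∀ n → (𝔽₂^ n → ℤ) → ℤ
cubeSum zero    f = f []
cubeSum (suc n) f = cubeSum n (f ∘ (0# ∷_)) + cubeSum n (f ∘ (1# ∷_))

cubeSum-cong : ∀ n {f g : 𝔽₂^ n → ℤ} → f ≗ g → cubeSum n f ≡ cubeSum n g
cubeSum-cong zero    f≗g = f≗g []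
cubeSum-cong (suc n) f≗g =
  cong₂ _+_ (cubeSum-cong n (f≗g ∘ (0# ∷_))) (cubeSum-cong n (f≗g ∘ (1# ∷_)))

cubeSum-* : ∀ n c (f : 𝔽₂^ n → ℤ) → cubeSum n (λ u → c * f u) ≡ c * cubeSum n f
cubeSum-* zero    c f = refl
cubeSum-* (suc n) c f = trans
  (cong₂ _+_ (cubeSum-* n c (f ∘ (0# ∷_))) (cubeSum-* n c (f ∘ (1# ∷_))))
  (sym (ℤ.*-distribˡ-+ c _ _))

cubeSum-+ : ∀ n (f g : 𝔽₂^ n → ℤ) →
            cubeSum n (λ u → f u + g u) ≡ cubeSum n f + cubeSum n g
cubeSum-+ zero    f g = refl
cubeSum-+ (suc n) f g = trans
  (cong₂ _+_ (cubeSum-+ n (f ∘ (0# ∷_)) (g ∘ (0# ∷_))) (cubeSum-+ n (f ∘ (1# ∷_)) (g ∘ (1# ∷_))))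
  (+-interchange (cubeSum n (f ∘ (0# ∷_))) (cubeSum n (g ∘ (0# ∷_)))
                 (cubeSum n (f ∘ (1# ∷_))) (cubeSum n (g ∘ (1# ∷_))))

cubeSum-∑ : ∀ n (f : Fin m → 𝔽₂^ n → ℤ) →
            cubeSum n (λ u → ∑[ i < m ] f i u) ≡ ∑[ i < m ] cubeSum n (f i)
cubeSum-∑ {m} zero    f = refl
cubeSum-∑ {m} (suc n) f = trans
  (cong₂ _+_ (cubeSum-∑ n (λ i → f i ∘ (0# ∷_))) (cubeSum-∑ n (λ i → f i ∘ (1# ∷_))))
  (sym (∑-distrib-+ {m} _ _))

cubeSum-nonneg : ∀ n {f : 𝔽₂^ n → ℤ} → (∀ u → 0ℤ ℤ.≤ f u) → 0ℤ ℤ.≤ cubeSum n f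
cubeSum-nonneg zero    f≥0 = f≥0 []
cubeSum-nonneg (suc n) f≥0 =
  ℤ.+-mono-≤ (cubeSum-nonneg n (f≥0 ∘ (0# ∷_))) (cubeSum-nonneg n (f≥0 ∘ (1# ∷_)))

f𝟎≤cubeSum : ∀ n {f : 𝔽₂^ n → ℤ} → (∀ u → 0ℤ ℤ.≤ f u) → f 𝟎 ℤ.≤ cubeSum n f
f𝟎≤cubeSum zero        f≥0 = ℤ.≤-refl
f𝟎≤cubeSum (suc n) {f} f≥0 = begin
  f 𝟎            ≡⟨ ℤ.+-identityʳ (f 𝟎) ⟨
  f 𝟎 + 0ℤ     ≤⟨ ℤ.+-mono-≤ (f𝟎≤cubeSum n (f≥0 ∘ (0# ∷_))) (cubeSum-nonneg n (f≥0 ∘ (1# ∷_))) ⟩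
  cubeSum (suc n) f ∎
  where open ℤ.≤-Reasoning

-- Vector arithmetic over `𝔽₂`.

+ᵥ-comm : (x y : 𝔽₂^ n) → x +ᵥ y ≡ y +ᵥ x
+ᵥ-comm = Vec.zipWith-comm Parity.+-comm

+ᵥ-assoc : (x y z : 𝔽₂^ n) → (x +ᵥ y) +ᵥ z ≡ x +ᵥ (y +ᵥ z)
+ᵥ-assoc = Vec.zipWith-assoc Parity.+-assoc

+ᵥ-identityˡ : (x : 𝔽₂^ n) → 𝟎 +ᵥ x ≡ x
+ᵥ-identityˡ = Vec.zipWith-identityˡ Parity.+-identityˡ

+ᵥ-identityʳ : (x : 𝔽₂^ n) → x +ᵥ 𝟎 ≡ x
+ᵥ-identityʳ = Vec.zipWith-identityʳ Parity.+-identityʳ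

x+[x+y]≡y : (x y : 𝔽₂^ n) → x +ᵥ (x +ᵥ y) ≡ y
x+[x+y]≡y x y = begin
  x +ᵥ (x +ᵥ y)  ≡⟨ +ᵥ-assoc x x y ⟨
  -- Negation in `𝔽₂` is the identity, so `x -ᵥ x` and `x +ᵥ x` agree by definition.
  (x +ᵥ x) +ᵥ y  ≡⟨ cong (_+ᵥ y) (x-x≡𝟎 x) ⟩
  𝟎 +ᵥ y         ≡⟨ +ᵥ-identityˡ y ⟩
  y              ∎
  where open ≡-Reasoning

x+y≡𝟎⇒y≡x : (x y : 𝔽₂^ n) → x +ᵥ y ≡ 𝟎 → y ≡ x
x+y≡𝟎⇒y≡x x y x+y≡𝟎 = begin
  y              ≡⟨ x+[x+y]≡y x y ⟨
  x +ᵥ (x +ᵥ y)  ≡⟨ cong (x +ᵥ_) x+y≡𝟎 ⟩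
  x +ᵥ 𝟎         ≡⟨ +ᵥ-identityʳ x ⟩
  x              ∎
  where open ≡-Reasoning

-- Characters of `𝔽₂^ n` and their orthogonality.

sgn : 𝔽₂ → ℤ
sgn 0ℙ = 1ℤ
sgn 1ℙ = -1ℤ

sgn-*-+ : ∀ a b c → sgn (a *₂ (b +₂ c)) ≡ sgn (a *₂ b) * sgn (a *₂ c)
sgn-*-+ 0ℙ b  c  = refl
sgn-*-+ 1ℙ 0ℙ 0ℙ = refl
sgn-*-+ 1ℙ 0ℙ 1ℙ = refl
sgn-*-+ 1ℙ 1ℙ 0ℙ = refl
sgn-*-+ 1ℙ 1ℙ 1ℙ = refl

χ : 𝔽₂^ n → 𝔽₂^ n → ℤ
χ []      []      = 1ℤ
χ (a ∷ u) (b ∷ x) = sgn (a *₂ b) * χ u x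

χ-+ : (u x y : 𝔽₂^ n) → χ u (x +ᵥ y) ≡ χ u x * χ u y
χ-+ []      []      []      = refl
χ-+ (a ∷ u) (b ∷ x) (c ∷ y) = begin
  sgn (a *₂ (b +₂ c)) * χ u (x +ᵥ y)
    ≡⟨ cong₂ _*_ (sgn-*-+ a b c) (χ-+ u x y) ⟩
  (sgn (a *₂ b) * sgn (a *₂ c)) * (χ u x * χ u y)
    ≡⟨ *-interchange (sgn (a *₂ b)) (sgn (a *₂ c)) (χ u x) (χ u y) ⟩
  (sgn (a *₂ b) * χ u x) * (sgn (a *₂ c) * χ u y)
    ∎
  where open ≡-Reasoning

χ-𝟎ˡ : (x : 𝔽₂^ n) → χ 𝟎 x ≡ 1ℤ
χ-𝟎ˡ []      = refl
χ-𝟎ˡ (b ∷ x) = trans (ℤ.*-identityˡ _) (χ-𝟎ˡ x)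

χ-𝟎ʳ : (u : 𝔽₂^ n) → χ u 𝟎 ≡ 1ℤ
χ-𝟎ʳ []       = refl
χ-𝟎ʳ (0ℙ ∷ u) = trans (ℤ.*-identityˡ _) (χ-𝟎ʳ u)
χ-𝟎ʳ (1ℙ ∷ u) = trans (ℤ.*-identityˡ _) (χ-𝟎ʳ u)

cubeSum-χ-𝟎 : ∀ n → cubeSum n (λ u → χ u 𝟎) ≡ + (2 ^ n)
cubeSum-χ-𝟎 zero    = refl
cubeSum-χ-𝟎 (suc n) = begin
  cubeSum n (λ u → 1ℤ * χ u 𝟎) + cubeSum n (λ u → 1ℤ * χ u 𝟎)
    ≡⟨ cong (λ s → s + s) (trans (cubeSum-* n 1ℤ _) (trans (ℤ.*-identityˡ _) (cubeSum-χ-𝟎 n))) ⟩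
  + (2 ^ n ℕ.+ 2 ^ n)
    ≡⟨ cong (λ s → + (2 ^ n ℕ.+ s)) (ℕ.+-identityʳ (2 ^ n)) ⟨
  + (2 ^ suc n) ∎
  where open ≡-Reasoning

-- Leading zeros of `z` only double the sum over the remaining coordinates; at the first `1` the two
-- halves of the cube carry opposite signs and cancel.
cubeSum-χ-≢𝟎 : (z : 𝔽₂^ n) → z ≢ 𝟎 → cubeSum n (λ u → χ u z) ≡ 0ℤ
cubeSum-χ-≢𝟎 []      z≢𝟎 = contradiction refl z≢𝟎
cubeSum-χ-≢𝟎 {suc n} (0ℙ ∷ z) z≢𝟎 =
  cong (λ s → s + s) (trans (cubeSum-* n 1ℤ _) (cong (1ℤ *_) (cubeSum-χ-≢𝟎 z (z≢𝟎 ∘ cong (0ℙ ∷_)))))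
cubeSum-χ-≢𝟎 {suc n} (1ℙ ∷ z) z≢𝟎 = trans
  (cong₂ _+_ (cubeSum-* n 1ℤ (λ u → χ u z)) (cubeSum-* n -1ℤ (λ u → χ u z)))
  (cancel (cubeSum n λ u → χ u z))
  where
  cancel : ∀ s → 1ℤ * s + -1ℤ * s ≡ 0ℤ
  cancel = solve-∀

-- The generators are nonzero and distinct.

lookup-∷ʳ-inject₁ : ∀ {A : Set} (xs : Vec A n) y i → lookup (xs ∷ʳ y) (inject₁ i) ≡ lookup xs i
lookup-∷ʳ-inject₁ (x ∷ xs) y zero    = refl
lookup-∷ʳ-inject₁ (x ∷ xs) y (suc i) = lookup-∷ʳ-inject₁ xs y i

lookup-∷ʳ-fromℕ : ∀ {A : Set} (xs : Vec A n) y → lookup (xs ∷ʳ y) (fromℕ n) ≡ y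
lookup-∷ʳ-fromℕ []       y = refl
lookup-∷ʳ-fromℕ (x ∷ xs) y = lookup-∷ʳ-fromℕ xs y

-- Literally the vector whose span is `F i`, so that `refl` proves membership in the singleton
-- there.
gen : Fin (suc n) → 𝔽₂^ n
gen = lookup (tabulate 𝐞 ∷ʳ 𝟏)

gen-inject₁ : (i : Fin n) → gen (inject₁ i) ≡ 𝐞 i
gen-inject₁ i = trans (lookup-∷ʳ-inject₁ (tabulate 𝐞) 𝟏 i) (Vec.lookup∘tabulate 𝐞 i)

gen-fromℕ : ∀ n → gen (fromℕ n) ≡ 𝟏
gen-fromℕ n = lookup-∷ʳ-fromℕ (tabulate 𝐞) 𝟏

lookup-𝐞-≡ : (i : Fin n) → lookup (𝐞 i) i ≡ 1#
lookup-𝐞-≡ i rewrite Vec.lookup∘tabulate (λ j → if does (i Fin.≟ j) then 1# else 0#) i with i Fin.≟ i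
... | yes _  = refl
... | no i≢i = contradiction refl i≢i

lookup-𝐞-≢ : {i j : Fin n} → i ≢ j → lookup (𝐞 i) j ≡ 0#
lookup-𝐞-≢ {i = i} {j} i≢j rewrite Vec.lookup∘tabulate (λ j → if does (i Fin.≟ j) then 1# else 0#) j with i Fin.≟ j
... | yes i≡j = contradiction i≡j i≢j
... | no _    = refl

0≢1 : 0# ≢ 1#
0≢1 ()

𝐞-injective : {i j : Fin n} → 𝐞 i ≡ 𝐞 j → i ≡ j
𝐞-injective {i = i} {j} 𝐞i≡𝐞j with i Fin.≟ j
... | yes i≡j = i≡j
... | no  i≢j = contradiction
  (trans (sym (lookup-𝐞-≢ i≢j)) (trans (cong (λ v → lookup v j) 𝐞i≡𝐞j) (lookup-𝐞-≡ j))) 0≢1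

-- In dimension at least 2 there is a coordinate other than `i`, and the two vectors differ at it.
-- In dimension 1 they coincide.
𝐞≢𝟏 : (i : Fin (2 ℕ.+ n)) → 𝐞 i ≢ 𝟏
𝐞≢𝟏 i 𝐞i≡𝟏 = 0≢1 (begin
  0#                ≡⟨ lookup-𝐞-≢ (Fin.punchInᵢ≢i i zero ∘ sym) ⟨
  lookup (𝐞 i) j    ≡⟨ cong (λ v → lookup v j) 𝐞i≡𝟏 ⟩
  lookup 𝟏 j        ≡⟨ Vec.lookup-replicate j 1# ⟩
  1#                ∎)
  where
  open ≡-Reasoning
  j = punchIn i zero

-- The index type belongs to dimension `2 ℕ.+ n`, where `𝐞≢𝟏` applies. Distinctness ensures that a
-- closed walk of length 2 uses the same generator twice, which gives the square of the adjacency
-- matrix its diagonal.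
gen-injective : {i j : Fin (3 ℕ.+ n)} → gen i ≡ gen j → i ≡ j
gen-injective {n} {i} {j} eq with view i | view j
... | ‵fromℕ      | ‵fromℕ      = refl
... | ‵fromℕ      | ‵inject₁ j′ = contradiction
  (trans (sym (gen-inject₁ j′)) (trans (sym eq) (gen-fromℕ _))) (𝐞≢𝟏 j′)
... | ‵inject₁ i′ | ‵fromℕ      = contradiction
  (trans (sym (gen-inject₁ i′)) (trans eq (gen-fromℕ _))) (𝐞≢𝟏 i′)
... | ‵inject₁ i′ | ‵inject₁ j′ = cong inject₁
  (𝐞-injective (trans (sym (gen-inject₁ i′)) (trans eq (gen-inject₁ j′))))

gen≢𝟎 : (i : Fin (2 ℕ.+ n)) → gen i ≢ 𝟎
gen≢𝟎 i gen≡𝟎 with view i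
... | ‵fromℕ      = 0≢1 (cong head (trans (sym gen≡𝟎) (gen-fromℕ _)))
... | ‵inject₁ i′ = 0≢1 (begin
  0#                 ≡⟨ Vec.lookup-replicate i′ 0# ⟨
  lookup 𝟎 i′        ≡⟨ cong (λ v → lookup v i′) (trans (sym gen≡𝟎) (gen-inject₁ i′)) ⟩
  lookup (𝐞 i′) i′   ≡⟨ lookup-𝐞-≡ i′ ⟩
  1#                 ∎)
  where open ≡-Reasoning

-- Eigenvalues and their residue modulo 4.

eigenvalue : 𝔽₂^ n → ℤ
eigenvalue {n} u = ∑[ i < suc n ] χ u (gen i)

eigenvalue-𝟎 : ∀ n → eigenvalue (𝟎 {n}) ≡ + suc n
eigenvalue-𝟎 n = begin
  ∑[ i < suc n ] χ 𝟎 (gen i)  ≡⟨ sum-cong-≗ {suc n} (λ i → χ-𝟎ˡ (gen i)) ⟩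
  ∑[ i < suc n ] 1ℤ           ≡⟨ sum-const (suc n) 1ℤ ⟩
  + suc n * 1ℤ              ≡⟨ ℤ.*-identityʳ (+ suc n) ⟩
  + suc n                     ∎
  where open ≡-Reasoning

χ-𝟏-±1 : (u : 𝔽₂^ n) → χ u 𝟏 ≡ 1ℤ ⊎ χ u 𝟏 ≡ -1ℤ
χ-𝟏-±1 []       = inj₁ refl
χ-𝟏-±1 (0ℙ ∷ u) with χ u 𝟏 | χ-𝟏-±1 u
... | _ | inj₁ refl = inj₁ refl
... | _ | inj₂ refl = inj₂ refl
χ-𝟏-±1 (1ℙ ∷ u) with χ u 𝟏 | χ-𝟏-±1 u
... | _ | inj₁ refl = inj₂ refl
... | _ | inj₂ refl = inj₁ refl

eigenvalue-split : (u : 𝔽₂^ n) → eigenvalue u ≡ ∑[ i < n ] χ u (𝐞 i) + χ u 𝟏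
eigenvalue-split {n} u = trans (sum-init-last (λ i → χ u (gen i)))
  (cong₂ _+_ (sum-cong-≗ {n} (λ i → cong (χ u) (gen-inject₁ i))) (cong (χ u) (gen-fromℕ n)))

tabulate-const : ∀ n {A : Set} (x : A) → tabulate {n = n} (λ _ → x) ≡ replicate n x
tabulate-const zero    x = refl
tabulate-const (suc n) x = cong (x ∷_) (tabulate-const n x)

χ-𝐞-zero : ∀ a (u : 𝔽₂^ n) → χ (a ∷ u) (𝐞 zero) ≡ sgn a
χ-𝐞-zero {n} a u = begin
  sgn (a *₂ 1#) * χ u (tabulate (λ _ → 0#))  ≡⟨ cong (λ x → sgn (a *₂ 1#) * χ u x) (tabulate-const n 0#) ⟩
  sgn (a *₂ 1#) * χ u 𝟎                      ≡⟨ cong₂ _*_ (cong sgn (Parity.*-identityʳ a)) (χ-𝟎ʳ u) ⟩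
  sgn a * 1ℤ                                 ≡⟨ ℤ.*-identityʳ (sgn a) ⟩
  sgn a                                        ∎
  where open ≡-Reasoning

χ-𝐞-suc : ∀ a (u : 𝔽₂^ n) i → χ (a ∷ u) (𝐞 (suc i)) ≡ χ u (𝐞 i)
χ-𝐞-suc a u i = trans (cong (λ b → sgn b * χ u (𝐞 i)) (Parity.*-zeroʳ a)) (ℤ.*-identityˡ _)

∑χ-cons : ∀ a (u : 𝔽₂^ n) →
  ∑[ i < suc n ] χ (a ∷ u) (𝐞 i) ≡ sgn a + ∑[ i < n ] χ u (𝐞 i)
∑χ-cons {n} a u = cong₂ _+_ (χ-𝐞-zero a u) (sum-cong-≗ {n} (χ-𝐞-suc a u))

-- If `u` has w ones, the left side is n - 2w + (-1)^w, so `l` is w/2 rounded up. Hence a leading 0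
-- keeps `l`, and a leading 1 raises it exactly when the number of ones so far is even.
∑χ-mod4 : (u : 𝔽₂^ n) →
  ∃[ l ] ∑[ i < n ] χ u (𝐞 i) + χ u 𝟏 ≡ + suc n - + 4 * l
∑χ-mod4 [] = 0ℤ , refl
∑χ-mod4 {suc n} (0ℙ ∷ u) with ∑χ-mod4 u
... | l , eq = l , (begin
  ∑[ i < suc n ] χ (0ℙ ∷ u) (𝐞 i) + 1ℤ * χ u 𝟏
    ≡⟨ cong (_+ 1ℤ * χ u 𝟏) (∑χ-cons 0ℙ u) ⟩
  (1ℤ + s) + 1ℤ * χ u 𝟏        ≡⟨ lem₁ s (χ u 𝟏) ⟩
  1ℤ + (s + χ u 𝟏)               ≡⟨ cong (_+_ 1ℤ) eq ⟩
  1ℤ + (+ suc n - + 4 * l)     ≡⟨ ℤ.+-assoc 1ℤ (+ suc n) (ℤ.- (+ 4 * l)) ⟨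
  + suc (suc n) - + 4 * l        ∎)
  where
  open ≡-Reasoning
  s = ∑[ i < n ] χ u (𝐞 i)
  lem₁ : ∀ s x → (1ℤ + s) + 1ℤ * x ≡ 1ℤ + (s + x)
  lem₁ = solve-∀
-- Flipping the first sign changes the sum by − 2 − 2 χ u 𝟏, which is 0 or − 4.
∑χ-mod4 {suc n} (1ℙ ∷ u) with ∑χ-mod4 u
... | l , eq = proj₁ flip , (begin
  ∑[ i < suc n ] χ (1ℙ ∷ u) (𝐞 i) + -1ℤ * χ u 𝟏
    ≡⟨ cong (_+ -1ℤ * χ u 𝟏) (∑χ-cons 1ℙ u) ⟩
  (-1ℤ + s) + -1ℤ * χ u 𝟏                       ≡⟨ lem₁ s (χ u 𝟏) ⟩
  1ℤ + (s + χ u 𝟏) - (+ 2 + + 2 * χ u 𝟏)    ≡⟨ cong₂ (λ x y → 1ℤ + x - y) eq (proj₂ flip) ⟩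
  1ℤ + (+ suc n - + 4 * l) - (+ 4 * (proj₁ flip - l))
                                                      ≡⟨ lem₂ (+ suc n) l (proj₁ flip) ⟩
  + suc (suc n) - + 4 * proj₁ flip                ∎)
  where
  open ≡-Reasoning
  s = ∑[ i < n ] χ u (𝐞 i)
  flip : ∃[ l′ ] + 2 + + 2 * χ u 𝟏 ≡ + 4 * (l′ - l)
  flip with χ u 𝟏 | χ-𝟏-±1 u
  ... | _ | inj₁ refl = 1ℤ + l , four l
    where
    four : ∀ l → + 4 ≡ + 4 * (1ℤ + l - l)
    four = solve-∀
  ... | _ | inj₂ refl = l , nought l
    where
    nought : ∀ l → 0ℤ ≡ + 4 * (l - l)
    nought = solve-∀
  lem₁ : ∀ s x → (-1ℤ + s) + -1ℤ * x ≡ 1ℤ + (s + x) - (+ 2 + + 2 * x)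
  lem₁ = solve-∀
  lem₂ : ∀ N l l′ → 1ℤ + (N - + 4 * l) - (+ 4 * (l′ - l)) ≡ 1ℤ + N - + 4 * l′
  lem₂ = solve-∀

eigenvalue-mod4 : (u : 𝔽₂^ n) → ∃[ l ] eigenvalue u ≡ + suc n - + 4 * l
eigenvalue-mod4 u with ∑χ-mod4 u
... | l , eq = l , trans (eigenvalue-split u) eq

-- Polynomials in the adjacency matrix, through characters.

-- The unnormalised Walsh-Hadamard transform. If A is the adjacency matrix and `w` is a polynomial p
-- in `eigenvalue`, its value at `z` is 2ⁿ times the entry of p(A) at any pair of vertices with
-- difference `z`.
transform : (𝔽₂^ n → ℤ) → 𝔽₂^ n → ℤ
transform {n} w z = cubeSum n λ u → w u * χ u z

-- On the matrix side this is multiplication by A + c. Since `χ u` is multiplicative, each summand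
-- `χ u (gen i)` of the eigenvalue is absorbed as a translation of `z` by `gen i`.
transform-[eigenvalue+c]* : ∀ c (w : 𝔽₂^ n → ℤ) z →
  transform (λ u → (eigenvalue u + c) * w u) z ≡
  ∑[ i < suc n ] transform w (gen i +ᵥ z) + c * transform w z
transform-[eigenvalue+c]* {n} c w z = begin
  cubeSum n (λ u → (eigenvalue u + c) * w u * χ u z)
    ≡⟨ cubeSum-cong n pointwise ⟩
  cubeSum n (λ u → ∑[ i < suc n ] (w u * χ u (gen i +ᵥ z)) + c * (w u * χ u z))
    ≡⟨ cubeSum-+ n _ _ ⟩
  cubeSum n (λ u → ∑[ i < suc n ] (w u * χ u (gen i +ᵥ z))) + cubeSum n (λ u → c * (w u * χ u z))
    ≡⟨ cong₂ _+_ (cubeSum-∑ {suc n} n (λ i u → w u * χ u (gen i +ᵥ z))) (cubeSum-* n c _) ⟩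
  ∑[ i < suc n ] transform w (gen i +ᵥ z) + c * transform w z
    ∎
  where
  open ≡-Reasoning
  expand : ∀ e c w x → (e + c) * w * x ≡ e * (w * x) + c * (w * x)
  expand = solve-∀
  rearrange : ∀ u i → χ u (gen i) * (w u * χ u z) ≡ w u * χ u (gen i +ᵥ z)
  rearrange u i = trans (x*[y*z]≡y*[x*z] (χ u (gen i)) (w u) (χ u z))
                        (cong (w u *_) (sym (χ-+ u (gen i) z)))
  pointwise : ∀ u → (eigenvalue u + c) * w u * χ u z ≡
                    ∑[ i < suc n ] (w u * χ u (gen i +ᵥ z)) + c * (w u * χ u z)
  pointwise u = begin
    (eigenvalue u + c) * w u * χ u z
      ≡⟨ expand (eigenvalue u) c (w u) (χ u z) ⟩
    eigenvalue u * (w u * χ u z) + c * (w u * χ u z)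
      ≡⟨ cong (_+ c * (w u * χ u z)) (*-distribʳ-sum {suc n} (w u * χ u z) (λ i → χ u (gen i))) ⟩
    ∑[ i < suc n ] (χ u (gen i) * (w u * χ u z)) + c * (w u * χ u z)
      ≡⟨ cong (_+ c * (w u * χ u z)) (sum-cong-≗ {suc n} (rearrange u)) ⟩
    ∑[ i < suc n ] (w u * χ u (gen i +ᵥ z)) + c * (w u * χ u z) ∎

transform-1-𝟎 : ∀ n → transform (λ _ → 1ℤ) (𝟎 {n}) ≡ + (2 ^ n)
transform-1-𝟎 n = trans (cubeSum-cong n λ u → ℤ.*-identityˡ (χ u 𝟎)) (cubeSum-χ-𝟎 n)

transform-1-≢𝟎 : (z : 𝔽₂^ n) → z ≢ 𝟎 → transform (λ _ → 1ℤ) z ≡ 0ℤ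
transform-1-≢𝟎 {n} z z≢𝟎 = trans (cubeSum-cong n λ u → ℤ.*-identityˡ (χ u z)) (cubeSum-χ-≢𝟎 z z≢𝟎)

-- The factor `1ℤ` is the constant weight, kept so that `transform-[eigenvalue+c]*` applies as it
-- stands.
linear : ℤ → 𝔽₂^ n → ℤ
linear c u = (eigenvalue u + c) * 1ℤ

quadratic : ℤ → ℤ → 𝔽₂^ n → ℤ
quadratic c c′ u = (eigenvalue u + c′) * linear c u

-- No sum of at most two generators equals `z`; the clauses list the points that two uses of
-- `transform-[eigenvalue+c]*` reach from `z`.
Far : 𝔽₂^ n → Set
Far z = z ≢ 𝟎 × (∀ i → gen i +ᵥ z ≢ 𝟎) × (∀ i j → gen j +ᵥ (gen i +ᵥ z) ≢ 𝟎)

transform-linear-zero : ∀ c (z : 𝔽₂^ n) → z ≢ 𝟎 → (∀ i → gen i +ᵥ z ≢ 𝟎) →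
                        transform (linear c) z ≡ 0ℤ
transform-linear-zero c z z≢𝟎 gen+z≢𝟎 = begin
  transform (linear c) z
    ≡⟨ transform-[eigenvalue+c]* c (λ _ → 1ℤ) z ⟩
  sum (λ i → transform (λ _ → 1ℤ) (gen i +ᵥ z)) + c * transform (λ _ → 1ℤ) z
    ≡⟨ cong₂ (λ s t → s + c * t) (sum-zero λ i → transform-1-≢𝟎 _ (gen+z≢𝟎 i)) (transform-1-≢𝟎 z z≢𝟎) ⟩
  0ℤ + c * 0ℤ
    ≡⟨ cong (_+_ 0ℤ) (ℤ.*-zeroʳ c) ⟩
  0ℤ ∎
  where open ≡-Reasoning

-- Both factors unfold into values of the transform of `1ℤ` at translates of `z` by at most two
-- generators. None of these is `𝟎`, so orthogonality makes all of them vanish.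
transform-quadratic-far : ∀ c c′ (z : 𝔽₂^ n) → Far z → transform (quadratic c c′) z ≡ 0ℤ
transform-quadratic-far c c′ z (z≢𝟎 , gen+z≢𝟎 , gen+gen+z≢𝟎) = begin
  transform (quadratic c c′) z
    ≡⟨ transform-[eigenvalue+c]* c′ (linear c) z ⟩
  sum (λ i → transform (linear c) (gen i +ᵥ z)) + c′ * transform (linear c) z
    ≡⟨ cong₂ (λ s t → s + c′ * t)
         (sum-zero λ i → transform-linear-zero c _ (gen+z≢𝟎 i) (gen+gen+z≢𝟎 i))
         (transform-linear-zero c z z≢𝟎 gen+z≢𝟎) ⟩
  0ℤ + c′ * 0ℤ
    ≡⟨ cong (_+_ 0ℤ) (ℤ.*-zeroʳ c′) ⟩
  0ℤ ∎
  where open ≡-Reasoning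

transform-linear-𝟎 : ∀ n c → transform (linear c) (𝟎 {suc n}) ≡ c * + (2 ^ suc n)
transform-linear-𝟎 n c = begin
  transform (linear c) (𝟎 {suc n})
    ≡⟨ transform-[eigenvalue+c]* c (λ _ → 1ℤ) (𝟎 {suc n}) ⟩
  sum (λ i → transform (λ _ → 1ℤ) (gen i +ᵥ 𝟎 {suc n})) + c * transform (λ _ → 1ℤ) (𝟎 {suc n})
    ≡⟨ cong₂ (λ s t → s + c * t)
         (sum-zero λ i → transform-1-≢𝟎 (gen i +ᵥ 𝟎 {suc n}) (gen≢𝟎 i ∘ trans (sym (+ᵥ-identityʳ (gen i)))))
         (transform-1-𝟎 (suc n)) ⟩
  0ℤ + c * + (2 ^ suc n)
    ≡⟨ ℤ.+-identityˡ _ ⟩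
  c * + (2 ^ suc n) ∎
  where open ≡-Reasoning

-- Among the translates of `gen i` by a generator only the one by `gen i` itself is `𝟎`. The
-- constant `c` sits on the diagonal and contributes nothing here.
transform-linear-gen : ∀ c (i : Fin (3 ℕ.+ n)) → transform (linear c) (gen i +ᵥ 𝟎) ≡ + (2 ^ (2 ℕ.+ n))
transform-linear-gen {n} c i = begin
  transform (linear c) (gen i +ᵥ 𝟎)
    ≡⟨ transform-[eigenvalue+c]* c (λ _ → 1ℤ) (gen i +ᵥ 𝟎) ⟩
  sum (λ j → D (gen j +ᵥ (gen i +ᵥ 𝟎))) + c * D (gen i +ᵥ 𝟎)
    ≡⟨ cong₂ (λ s t → s + c * t)
         (sum-single i (λ j → D (gen j +ᵥ (gen i +ᵥ 𝟎))) λ j j≢i → transform-1-≢𝟎 _ (gens-differ j j≢i))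
         (transform-1-≢𝟎 _ (gen≢𝟎 i ∘ trans (sym (+ᵥ-identityʳ (gen i))))) ⟩
  D (gen i +ᵥ (gen i +ᵥ 𝟎)) + c * 0ℤ
    ≡⟨ cong₂ _+_ (trans (cong D (x+[x+y]≡y (gen i) 𝟎)) (transform-1-𝟎 (2 ℕ.+ n))) (ℤ.*-zeroʳ c) ⟩
  + (2 ^ (2 ℕ.+ n)) + 0ℤ
    ≡⟨ ℤ.+-identityʳ _ ⟩
  + (2 ^ (2 ℕ.+ n)) ∎
  where
  open ≡-Reasoning
  D : 𝔽₂^ (2 ℕ.+ n) → ℤ
  D = transform (λ _ → 1ℤ)
  gens-differ : ∀ j → j ≢ i → gen j +ᵥ (gen i +ᵥ 𝟎) ≢ 𝟎
  gens-differ j j≢i eq = j≢i (gen-injective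
    (sym (trans (sym (+ᵥ-identityʳ (gen i))) (x+y≡𝟎⇒y≡x _ _ eq))))

-- The diagonal of (A + c′)(A + c): each of the `3 ℕ.+ n` generators returns once in A², the terms
-- linear in A have zero diagonal, and the constants give `c′ * c`.
transform-quadratic-𝟎 : ∀ n c c′ → transform (quadratic c c′) (𝟎 {2 ℕ.+ n}) ≡
                                   + (2 ^ (2 ℕ.+ n)) * (+ (3 ℕ.+ n) + c′ * c)
transform-quadratic-𝟎 n c c′ = begin
  transform (quadratic c c′) (𝟎 {2 ℕ.+ n})
    ≡⟨ transform-[eigenvalue+c]* c′ (linear c) (𝟎 {2 ℕ.+ n}) ⟩
  sum (λ i → transform (linear c) (gen i +ᵥ 𝟎 {2 ℕ.+ n})) + c′ * transform (linear c) (𝟎 {2 ℕ.+ n})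
    ≡⟨ cong₂ (λ s t → s + c′ * t)
         (trans (sum-cong-≗ {3 ℕ.+ n} (transform-linear-gen c)) (sum-const (3 ℕ.+ n) 2ⁿ))
         (transform-linear-𝟎 (suc n) c) ⟩
  + (3 ℕ.+ n) * 2ⁿ + c′ * (c * 2ⁿ)
    ≡⟨ factor-out (+ (3 ℕ.+ n)) c c′ 2ⁿ ⟩
  2ⁿ * (+ (3 ℕ.+ n) + c′ * c) ∎
  where
  open ≡-Reasoning
  2ⁿ = + (2 ^ (2 ℕ.+ n))
  factor-out : ∀ N c c′ x → N * x + c′ * (c * x) ≡ x * (N + c′ * c)
  factor-out = solve-∀

-- A ratio bound of Hoffman type.

-- The quadratic form of a matrix polynomial at the indicator of a set, computed in two bases.
-- Expanding the square gives products of two values of `χ u`, which merge by `χ-+`.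
cubeSum-square : ∀ (w : 𝔽₂^ n → ℤ) (v : Fin m → 𝔽₂^ n) →
  cubeSum n (λ u → w u * (∑[ a < m ] χ u (v a) * ∑[ a < m ] χ u (v a))) ≡
  ∑[ a < m ] ∑[ b < m ] transform w (v a +ᵥ v b)
cubeSum-square {n} {m} w v = begin
  cubeSum n (λ u → w u * (S u * S u))
    ≡⟨ cubeSum-cong n pointwise ⟩
  cubeSum n (λ u → ∑[ a < m ] ∑[ b < m ] (w u * χ u (v a +ᵥ v b)))
    ≡⟨ cubeSum-∑ {m} n (λ a u → ∑[ b < m ] (w u * χ u (v a +ᵥ v b))) ⟩
  ∑[ a < m ] cubeSum n (λ u → ∑[ b < m ] (w u * χ u (v a +ᵥ v b)))
    ≡⟨ sum-cong-≗ {m} (λ a → cubeSum-∑ {m} n (λ b u → w u * χ u (v a +ᵥ v b))) ⟩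
  ∑[ a < m ] ∑[ b < m ] transform w (v a +ᵥ v b) ∎
  where
  open ≡-Reasoning
  S : 𝔽₂^ n → ℤ
  S u = ∑[ a < m ] χ u (v a)
  row : ∀ u a → w u * (χ u (v a) * S u) ≡ ∑[ b < m ] (w u * χ u (v a +ᵥ v b))
  row u a = begin
    w u * (χ u (v a) * S u)
      ≡⟨ cong (w u *_) (*-distribˡ-sum {m} (χ u (v a)) (λ b → χ u (v b))) ⟩
    w u * ∑[ b < m ] (χ u (v a) * χ u (v b))
      ≡⟨ *-distribˡ-sum {m} (w u) (λ b → χ u (v a) * χ u (v b)) ⟩
    ∑[ b < m ] (w u * (χ u (v a) * χ u (v b)))
      ≡⟨ sum-cong-≗ {m} (λ b → cong (w u *_) (sym (χ-+ u (v a) (v b)))) ⟩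
    ∑[ b < m ] (w u * χ u (v a +ᵥ v b)) ∎
  pointwise : ∀ u → w u * (S u * S u) ≡ ∑[ a < m ] ∑[ b < m ] (w u * χ u (v a +ᵥ v b))
  pointwise u = begin
    w u * (S u * S u)
      ≡⟨ cong (w u *_) (*-distribʳ-sum {m} (S u) (λ a → χ u (v a))) ⟩
    w u * ∑[ a < m ] (χ u (v a) * S u)
      ≡⟨ *-distribˡ-sum {m} (w u) (λ a → χ u (v a) * S u) ⟩
    ∑[ a < m ] (w u * (χ u (v a) * S u))
      ≡⟨ sum-cong-≗ {m} (row u) ⟩
    ∑[ a < m ] ∑[ b < m ] (w u * χ u (v a +ᵥ v b)) ∎

0≤i*i : ∀ i → 0ℤ ℤ.≤ i * i
0≤i*i (+ k)      = subst (0ℤ ℤ.≤_) (ℤ.pos-* k k) (ℤ.+≤+ z≤n)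
0≤i*i ℤ.-[1+ k ] = ℤ.+≤+ z≤n

-- Integrality is essential: no integer lies strictly between the roots -1 and 0.
0≤[1+i]*i : ∀ i → 0ℤ ℤ.≤ (1ℤ + i) * i
0≤[1+i]*i (+ k)          = subst (0ℤ ℤ.≤_) (ℤ.pos-* (suc k) k) (ℤ.+≤+ z≤n)
0≤[1+i]*i ℤ.-[1+ zero ]  = ℤ.+≤+ z≤n
0≤[1+i]*i ℤ.-[1+ suc k ] = ℤ.+≤+ z≤n

0≤* : ∀ {i j} → 0ℤ ℤ.≤ i → 0ℤ ℤ.≤ j → 0ℤ ℤ.≤ i * j
0≤* {+ i} {+ j} _ _ = subst (0ℤ ℤ.≤_) (ℤ.pos-* i j) (ℤ.+≤+ z≤n)

-- Both sides are the two estimates of one spectral sum, so a common factor `+ m` remains; it can be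
-- cancelled only for a nonempty family.
ratio-bound : ∀ c c′ → (∀ (u : 𝔽₂^ (2 ℕ.+ n)) → 0ℤ ℤ.≤ quadratic c c′ u) →
  (v : Fin m → 𝔽₂^ (2 ℕ.+ n)) → (∀ {a b} → a ≢ b → Far (v a +ᵥ v b)) →
  + m * (+ m * ((+ (3 ℕ.+ n) + c′) * (+ (3 ℕ.+ n) + c))) ℤ.≤
  + m * (+ (2 ^ (2 ℕ.+ n)) * (+ (3 ℕ.+ n) + c′ * c))
ratio-bound {n} {m} c c′ q≥0 v far = begin
  + m * (+ m * ((+ N + c′) * (+ N + c)))
    ≡⟨ rearrange (+ m) (+ N + c′) (+ N + c) ⟩
  (+ N + c′) * ((+ N + c) * 1ℤ) * (+ m * + m)
    ≡⟨ cong₂ (λ e s → (e + c′) * ((e + c) * 1ℤ) * (s * s)) (eigenvalue-𝟎 (2 ℕ.+ n)) S-𝟎 ⟨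
  quadratic c c′ (𝟎 {2 ℕ.+ n}) * (S 𝟎 * S 𝟎)
    ≤⟨ f𝟎≤cubeSum (2 ℕ.+ n) (λ u → 0≤* (q≥0 u) (0≤i*i (S u))) ⟩
  cubeSum (2 ℕ.+ n) (λ u → quadratic c c′ u * (S u * S u))
    ≡⟨ cubeSum-square (quadratic c c′) v ⟩
  ∑[ a < m ] ∑[ b < m ] transform (quadratic c c′) (v a +ᵥ v b)
    ≡⟨ sum-cong-≗ {m} row ⟩
  ∑[ a < m ] (+ (2 ^ (2 ℕ.+ n)) * (+ N + c′ * c))
    ≡⟨ sum-const m _ ⟩
  + m * (+ (2 ^ (2 ℕ.+ n)) * (+ N + c′ * c)) ∎
  where
  open ℤ.≤-Reasoning
  N = 3 ℕ.+ n
  S : 𝔽₂^ (2 ℕ.+ n) → ℤ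
  S u = ∑[ a < m ] χ u (v a)
  S-𝟎 : S 𝟎 ≡ + m
  S-𝟎 = trans (sum-cong-≗ {m} (λ a → χ-𝟎ˡ (v a))) (trans (sum-const m 1ℤ) (ℤ.*-identityʳ (+ m)))
  rearrange : ∀ m x y → m * (m * (x * y)) ≡ x * (y * 1ℤ) * (m * m)
  rearrange = solve-∀
  row : ∀ a → ∑[ b < m ] transform (quadratic c c′) (v a +ᵥ v b) ≡
              + (2 ^ (2 ℕ.+ n)) * (+ N + c′ * c)
  row a = trans
    (sum-single a (λ b → transform (quadratic c c′) (v a +ᵥ v b))
      λ b b≢a → transform-quadratic-far c c′ _ (far (b≢a ∘ sym)))
    (trans (cong (transform (quadratic c c′)) (x-x≡𝟎 (v a))) (transform-quadratic-𝟎 n c c′))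

-- The roots r and r - 4 are consecutive members of the residue class that contains every
-- eigenvalue. Writing the eigenvalue as r + 4(q - l) turns the quadratic into 16 times a product of
-- two consecutive integers.
quadratic-nonneg : ∀ r q → suc n ≡ r ℕ.+ q ℕ.* 4 → (u : 𝔽₂^ n) →
                   0ℤ ℤ.≤ quadratic (ℤ.- (+ r)) (+ 4 - + r) u
quadratic-nonneg {n} r q N≡r+4q u with eigenvalue-mod4 u
... | l , eq = subst (0ℤ ℤ.≤_) (sym quadratic≡) (0≤* {+ 16} (ℤ.+≤+ z≤n) (0≤[1+i]*i (+ q - l)))
  where
  open ≡-Reasoning
  N≡ : + suc n ≡ + r + + q * + 4
  N≡ = trans (cong +_ N≡r+4q) (cong (_+_ (+ r)) (ℤ.pos-* q 4))
  lem : ∀ r q l → (r + q * + 4 - + 4 * l + (+ 4 - r)) * ((r + q * + 4 - + 4 * l + ℤ.- r) * 1ℤ) ≡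
                  + 16 * ((1ℤ + (q - l)) * (q - l))
  lem = solve-∀
  quadratic≡ : quadratic (ℤ.- (+ r)) (+ 4 - + r) u ≡ + 16 * ((1ℤ + (+ q - l)) * (+ q - l))
  quadratic≡ = begin
    quadratic (ℤ.- (+ r)) (+ 4 - + r) u
      ≡⟨ cong (λ e → (e + (+ 4 - + r)) * ((e + ℤ.- (+ r)) * 1ℤ)) (trans eq (cong (_- + 4 * l) N≡)) ⟩
    (+ r + + q * + 4 - + 4 * l + (+ 4 - + r)) * ((+ r + + q * + 4 - + 4 * l + ℤ.- (+ r)) * 1ℤ)
      ≡⟨ lem (+ r) (+ q) l ⟩
    + 16 * ((1ℤ + (+ q - l)) * (+ q - l)) ∎

-- From graph distance to sums of generators.

∈⇒∈Span : ∀ {ℓ} {X : Pred (𝔽₂^ n) ℓ} {v} → X v → Span X v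
∈⇒∈Span {X = X} {v} v∈X = subst (Span X) 1*v+𝟎≡v (addˢ 1# v∈X zeroˢ)
  where
  1*v+𝟎≡v : 1# *ᵥ v +ᵥ 𝟎 ≡ v
  1*v+𝟎≡v = trans (+ᵥ-identityʳ _) (Vec.map-id v)

spannedBy-⁅⁆ : (i : Fin (suc n)) → SpannedBy ⁅ i ⁆ (gen i)
spannedBy-⁅⁆ i = ∈⇒∈Span ((i , Subset.x∈⁅x⁆ i) , ∈⇒∈Span refl)

spannedBy-∅ : {I : Subset (suc n)} {x : 𝔽₂^ n} → ∣ I ∣ ≡ 0 → SpannedBy I x → x ≡ 𝟎
spannedBy-∅ _     zeroˢ                         = refl
spannedBy-∅ {I = I} ∣I∣≡0 (addˢ _ ((i , i∈I) , _) _) = contradiction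
  (begin
    1          ≡⟨ Subset.∣⁅x⁆∣≡1 i ⟨
    ∣ ⁅ i ⁆ ∣  ≤⟨ Subset.p⊆q⇒∣p∣≤∣q∣ (λ j∈ → subst (_∈ₛ I) (sym (Subset.x∈⁅y⁆⇒x≡y i j∈)) i∈I) ⟩
    ∣ I ∣      ≡⟨ ∣I∣≡0 ⟩
    0          ∎)
  λ ()
  where open ℕ.≤-Reasoning

gen-weight : (i : Fin (2 ℕ.+ n)) → IsWeight (gen i) 1
gen-weight i = (⁅ i ⁆ , Subset.∣⁅x⁆∣≡1 i , spannedBy-⁅⁆ i) , least
  where
  least : ∀ k → ∃[ I ] (∣ I ∣ ≡ k × SpannedBy I (gen i)) → 1 ℕ.≤ k
  least zero    (_ , ∣I∣≡0 , span) = contradiction (spannedBy-∅ ∣I∣≡0 span) (gen≢𝟎 i)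
  least (suc _) _                  = s≤s z≤n

adjacent : (x y : 𝔽₂^ (suc n)) (i : Fin (2 ℕ.+ n)) → x +ᵥ y ≡ gen i → IsDistance x y 1
adjacent x y i x+y≡gen = subst (λ v → IsWeight v 1) (sym x+y≡gen) (gen-weight i)

-- If `x +ᵥ y` were a sum of one or two generators, following them from `x` would be a walk to `y`
-- of length 1 or 2; in the second case `x +ᵥ gen i` is the midpoint.
distanceExceeds⇒far : (x y : 𝔽₂^ (suc n)) → x ≢ y →
                      DistanceExceeds (G-pr (suc n)) 2 x y → Far (x +ᵥ y)
distanceExceeds⇒far {n} x y x≢y dist = x≢y ∘ sym ∘ x+y≡𝟎⇒y≡x x y , no-edge , no-path
  where
  no-edge : ∀ i → gen i +ᵥ (x +ᵥ y) ≢ 𝟎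
  no-edge i eq = contradiction
    (dist 1 (step (adjacent x y i (x+y≡𝟎⇒y≡x _ _ eq)) stop)) λ { (s≤s ()) }
  no-path : ∀ i j → gen j +ᵥ (gen i +ᵥ (x +ᵥ y)) ≢ 𝟎
  no-path i j eq = contradiction
    (dist 2 (step (adjacent x (x +ᵥ gen i) i (x+[x+y]≡y x (gen i)))
            (step (adjacent (x +ᵥ gen i) y j second) stop)))
    λ { (s≤s (s≤s ())) }
    where
    second : (x +ᵥ gen i) +ᵥ y ≡ gen j
    second = trans (cong (_+ᵥ y) (+ᵥ-comm x (gen i)))
                   (trans (+ᵥ-assoc (gen i) x y) (x+y≡𝟎⇒y≡x _ _ eq))

-- The bound for independent sets, in integers and in rationals.

lookup-injective : ∀ {A : Set} {xs : List A} → Unique xs → ∀ {i j} →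
                   List.lookup xs i ≡ List.lookup xs j → i ≡ j
lookup-injective (_  ∷ _) {zero}  {zero}  _  = refl
lookup-injective (x≢ ∷ _) {zero}  {suc j} eq = contradiction eq (All.lookup x≢ (∈-lookup j))
lookup-injective (x≢ ∷ _) {suc i} {zero}  eq = contradiction (sym eq) (All.lookup x≢ (∈-lookup i))
lookup-injective (_  ∷ u) {suc i} {suc j} eq = cong suc (lookup-injective u eq)

-- With N = n + 3 generators in dimension n + 2, `a` is N + p(0), and `d₁` and `d₂` are the factors
-- N - r + 4 and N - r of p(N). Passing them as natural numbers lets each residue class supply its
-- own closed form.
independent-bound : ∀ {S : List (𝔽₂^ (2 ℕ.+ n))} → Unique S → Independent (G-pr (2 ℕ.+ n)) 2 S →
  ∀ r q a d₁ d₂ → 3 ℕ.+ n ≡ r ℕ.+ q ℕ.* 4 →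
  + a ≡ + (3 ℕ.+ n) + (+ 4 - + r) * ℤ.- (+ r) →
  + d₁ ≡ + (3 ℕ.+ n) + (+ 4 - + r) →
  + d₂ ≡ + (3 ℕ.+ n) + ℤ.- (+ r) →
  length S ℕ.* (d₁ ℕ.* d₂) ℕ.≤ 2 ^ (2 ℕ.+ n) ℕ.* a
-- The empty set is treated apart because the other case cancels `length S`.
independent-bound {S = []} _ _ _ _ _ _ _ _ _ _ _ = z≤n
independent-bound {n} {S = S@(_ ∷ _)} unique indep r q a d₁ d₂ N≡ a≡ d₁≡ d₂≡ =
  ℤ.drop‿+≤+ (begin
    + (length S ℕ.* (d₁ ℕ.* d₂))
      ≡⟨ trans (ℤ.pos-* (length S) (d₁ ℕ.* d₂)) (cong (+ length S *_) (ℤ.pos-* d₁ d₂)) ⟩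
    + length S * (+ d₁ * + d₂)
      ≡⟨ cong₂ (λ x y → + length S * (x * y)) d₁≡ d₂≡ ⟩
    + length S * ((+ (3 ℕ.+ n) + (+ 4 - + r)) * (+ (3 ℕ.+ n) + ℤ.- (+ r)))
      ≤⟨ ℤ.*-cancelˡ-≤-pos _ _ (+ length S)
           (ratio-bound (ℤ.- (+ r)) (+ 4 - + r) (quadratic-nonneg r q N≡) (List.lookup S) far) ⟩
    + (2 ^ (2 ℕ.+ n)) * (+ (3 ℕ.+ n) + (+ 4 - + r) * ℤ.- (+ r))
      ≡⟨ cong (+ (2 ^ (2 ℕ.+ n)) *_) a≡ ⟨
    + (2 ^ (2 ℕ.+ n)) * + a
      ≡⟨ ℤ.pos-* (2 ^ (2 ℕ.+ n)) a ⟨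
    + (2 ^ (2 ℕ.+ n) ℕ.* a) ∎)
  where
  open ℤ.≤-Reasoning
  far : ∀ {a b} → a ≢ b → Far (List.lookup S a +ᵥ List.lookup S b)
  far {a} {b} a≢b = distanceExceeds⇒far (List.lookup S a) (List.lookup S b) Sa≢Sb
    (indep (∈-lookup a) (∈-lookup b) Sa≢Sb)
    where
    Sa≢Sb : List.lookup S a ≢ List.lookup S b
    Sa≢Sb = a≢b ∘ lookup-injective unique

-- Since `_/_` reduces to lowest terms, the comparison is made in the unnormalised rationals, where
-- cross-multiplication is available.
≤-fraction : ∀ α b c d .{{_ : ℕ.NonZero d}} → α ℕ.* d ℕ.≤ b ℕ.* c →
             + α / 1 ≤ (+ b / 1) ℚ.* (+ c / d)
≤-fraction α b c (suc d-1) αd≤bc = ℚ.toℚᵘ-cancel-≤ (begin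
  ℚ.toℚᵘ (+ α / 1)                                 ≃⟨ ℚ.toℚᵘ-fromℚᵘ (ℚᵘ.mkℚᵘ (+ α) 0) ⟩
  ℚᵘ.mkℚᵘ (+ α) 0                                  ≤⟨ ℚᵘ.*≤* cross ⟩
  ℚᵘ.mkℚᵘ (+ b) 0 ℚᵘ.* ℚᵘ.mkℚᵘ (+ c) d-1           ≃⟨ ℚᵘ.*-cong (ℚ.toℚᵘ-fromℚᵘ (ℚᵘ.mkℚᵘ (+ b) 0)) (ℚ.toℚᵘ-fromℚᵘ (ℚᵘ.mkℚᵘ (+ c) d-1)) ⟨
  ℚ.toℚᵘ (+ b / 1) ℚᵘ.* ℚ.toℚᵘ (+ c / suc d-1)     ≃⟨ ℚ.toℚᵘ-homo-* (+ b / 1) (+ c / suc d-1) ⟨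
  ℚ.toℚᵘ ((+ b / 1) ℚ.* (+ c / suc d-1))           ∎)
  where
  open ℚᵘ.≤-Reasoning
  cross : + α * + (1 ℕ.* suc d-1) ℤ.≤ (+ b * + c) * + 1
  cross = subst₂ ℤ._≤_
    (trans (cong +_ (cong (α ℕ.*_) (sym (ℕ.*-identityˡ (suc d-1))))) (ℤ.pos-* α (1 ℕ.* suc d-1)))
    (trans (ℤ.pos-* b c) (sym (ℤ.*-identityʳ _)))
    (ℤ.+≤+ αd≤bc)

-- For n congruent to 2 or 3 modulo 4, N + p(0) equals the factor N - r of p(N); cancelling it
-- leaves the numerator 1.
*-cancel-≤ : ∀ x d y a .{{_ : ℕ.NonZero a}} → x ℕ.* (d ℕ.* a) ℕ.≤ y ℕ.* a → x ℕ.* d ℕ.≤ y ℕ.* 1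
*-cancel-≤ x d y a xda≤ya = ℕ.*-cancelʳ-≤ (x ℕ.* d) (y ℕ.* 1) a
  (subst₂ ℕ._≤_ (sym (ℕ.*-assoc x d a)) (cong (ℕ._* a) (sym (ℕ.*-identityʳ y))) xda≤ya)

theorem40 : (n : ℕ) (n≥3 : n ≥ 3) (α₂ : ℕ) →
    IsIndependenceNumber (G-pr n) 2 α₂ →
    + α₂ / 1 ≤ bound n n≥3
theorem40 n@(suc (suc (suc m))) (s≤s (s≤s (s≤s z≤n))) _ ((S , unique , indep , refl) , _)
  -- Abstracting the remainder also reduces `bound` to the fraction of its residue class.
  with n ℕ.mod 4 | n ℕ./ 4 | ℕ.DivMod.property (n ℕ.divMod 4)
-- There are n + 1 generators, so r is one more than the remainder of n: here r = 1 and p(λ) = (λ -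
-- 1)(λ + 3).
... | 0F | q | n≡ = ≤-fraction (length S) (2 ^ n) (n ∸ 2) (n ℕ.* (n ℕ.+ 4))
  (subst (λ d → length S ℕ.* d ℕ.≤ 2 ^ n ℕ.* (n ∸ 2)) (ℕ.*-comm (n ℕ.+ 4) n)
    (independent-bound unique indep 1 q (n ∸ 2) (n ℕ.+ 4) n (cong suc n≡)
      refl (cong +_ (ℕ.+-suc n 3)) refl))
... | 1F | q | n≡ = ≤-fraction (length S) (2 ^ n) (n ∸ 3) ((n ℕ.+ 3) ℕ.* (n ∸ 1))
  (independent-bound unique indep 2 q (n ∸ 3) (n ℕ.+ 3) (n ∸ 1) (cong suc n≡)
    refl (cong +_ (ℕ.+-suc n 2)) refl)
... | 2F | q | n≡ = ≤-fraction (length S) (2 ^ n) 1 (n ℕ.+ 2)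
  (*-cancel-≤ (length S) _ (2 ^ n) (n ∸ 2) (independent-bound unique indep 3 q (n ∸ 2) (n ℕ.+ 2) (n ∸ 2) (cong suc n≡)
    refl (cong +_ (ℕ.+-suc n 1)) refl))
-- Now n + 1 is divisible by 4: the residue wraps to r = 0 and the quotient becomes `suc q`.
... | 3F | q | n≡ = ≤-fraction (length S) (2 ^ n) 1 (n ℕ.+ 5)
  (*-cancel-≤ (length S) _ (2 ^ n) (suc n) (independent-bound unique indep 0 (suc q) (suc n) (n ℕ.+ 5) (suc n) (cong suc n≡)
    (sym (ℤ.+-identityʳ (+ suc n))) (cong +_ (ℕ.+-suc n 4)) (sym (ℤ.+-identityʳ (+ suc n)))))
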